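{- Let $H$ be a finite bipartite graph and let $\tilde{H}$ be its extended line graph. Then for every integer $d\geq 1$ and every $d$-regular simple graph $G$ on $n$ vertices, $$\hom(G,\tilde{H})\leq \hom(K_{d+1},\tilde{H})^{n/(d+1)},$$ equivalently $p_{\tilde{H}}(G)\leq p_{\tilde{H}}(K_{d+1})$.
   Context: For graphs $G$ and $H$ (where $H$ may have loops), a homomorphism is a map $\varphi:V(G)\to V(H)$ such that $(\varphi(u),\varphi(v))\in E(H)$ whenever $(u,v)\in E(G)$; $\hom(G,H)$ denotes the number of homomorphisms from $G$ to $H$, and $p_H(G)=\hom(G,H)^{1/|V(G)|}$. $K_{d+1}$ is the complete graph on $d+1$ vertices. The extended line graph $\tilde{H}$ of a bipartite graph $H$ has vertex set $E(H)$, and two edges $e,f$ of $H$ are adjacent in $\tilde{H}$ if (a) $e=f$ (so every vertex of $\tilde{H}$ has a loop), or (b) $e$ and $f$ share a common vertex, or (c) $e$ and $f$ are opposite edges of a $4$-cycle in $H$. -}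

module Defs where

open import Data.Bool using (Bool; true; false; not; _∧_; _∨_; if_then_else_)
open import Data.Nat using (ℕ; zero; suc; _+_; _<ᵇ_)
open import Data.Fin using (Fin; zero; suc; toℕ)
open import Data.Fin.Properties using (_≟_)
open import Data.List using (List; []; _∷_; map; concatMap; length; filterᵇ; lookup; sum; foldr)
open import Data.List.Base using (allFin)
open import Data.Product using (_×_; _,_; proj₁; proj₂; ∃)
open import Relation.Nullary.Decidable using (⌊_⌋)
open import Relation.Binary.PropositionalEquality using (_≡_; _≢_)

Graph : ℕ → Set
Graph n = Fin n → Fin n → Bool

record IsSimple {n : ℕ} (G : Graph n) : Set where
  field
    symmetric  : ∀ i j → G i j ≡ G j i
    loopless   : ∀ i → G i i ≡ false

IsBipartite : {n : ℕ} → Graph n → Set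
IsBipartite {n} G = ∃ λ (c : Fin n → Bool) → ∀ i j → G i j ≡ true → c i ≢ c j

degree : {n : ℕ} → Graph n → Fin n → ℕ
degree {n} G i = length (filterᵇ (G i) (allFin n))

IsRegular : ℕ → {n : ℕ} → Graph n → Set
IsRegular d {n} G = ∀ i → degree G i ≡ d

_==_ : {n : ℕ} → Fin n → Fin n → Bool
a == b = ⌊ a ≟ b ⌋

K : (n : ℕ) → Graph n
K n i j = not (i == j)

edgeList : {m : ℕ} → Graph m → List (Fin m × Fin m)
edgeList {m} H =
  filterᵇ (λ p → (toℕ (proj₁ p) <ᵇ toℕ (proj₂ p)) ∧ H (proj₁ p) (proj₂ p))
    (concatMap (λ u → map (λ v → (u , v)) (allFin m)) (allFin m))

numEdges : {m : ℕ} → Graph m → ℕ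
numEdges H = length (edgeList H)

edge : {m : ℕ} (H : Graph m) → Fin (numEdges H) → Fin m × Fin m
edge H e = lookup (edgeList H) e

-- Extended line graph: vertices are the edges of H; e ~ f iff
-- (a) e = f, (b) e and f share a vertex, or
-- (c) e and f are opposite edges of a 4-cycle of H.
extLine : {m : ℕ} (H : Graph m) → Graph (numEdges H)
extLine H e f with edge H e | edge H f
... | (a , b) | (c , d) =
  (e == f)
  ∨ ((a == c) ∨ (a == d) ∨ (b == c) ∨ (b == d))
  ∨ (distinct ∧ ((H a c ∧ H b d) ∨ (H a d ∧ H b c)))
  where
  distinct = not ((a == c) ∨ (a == d) ∨ (b == c) ∨ (b == d))

cons : {n k : ℕ} → Fin k → (Fin n → Fin k) → Fin (suc n) → Fin k
cons a f zero    = a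
cons a f (suc i) = f i

allFuns : (n k : ℕ) → List (Fin n → Fin k)
allFuns zero    k = (λ ()) ∷ []
allFuns (suc n) k = concatMap (λ a → map (cons a) (allFuns n k)) (allFin k)

isHom : {n k : ℕ} → Graph n → Graph k → (Fin n → Fin k) → Bool
isHom {n} G H f =
  allB (λ i → allB (λ j → not (G i j) ∨ H (f i) (f j)))
  where
  allB : (Fin n → Bool) → Bool
  allB p = foldr (λ i acc → p i ∧ acc) true (allFin n)

hom : {n k : ℕ} → Graph n → Graph k → ℕ
hom {n} {k} G H = length (filterᵇ (isHom G H) (allFuns n k))

{-# OPTIONS --safe #-}

-- Orient every edge of H from one colour class to the other. Two edges (u , v) and (w , z) are
-- adjacent in the extended line graph iff u z and w v are edges of H. Hence homomorphisms from G
-- to the extended line graph are side-preserving homomorphisms to H of the (d+1)-regular bipartite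
-- double cover of G with a perfect matching added, and K_{d+1} gives K_{d+1,d+1}. The bound is
-- then the Galvin–Tetali inequality for bipartite graphs: summing out one side gives
--   hom = ∑_l ∏_j ν (l restricted to N[j]),
-- where ν counts common neighbours, and each vertex lies in d+1 of the sets N[j], so Finner's
-- generalised Hölder inequality bounds hom^(d+1) by ∏_j ∑_{us ∈ V(H)^(d+1)} ν(us)^(d+1).
-- To stay in ℕ, Hölder and Finner are stated without roots: a bound F^D ≤ ∏ W, holding
-- pointwise, is inherited by the sums.
module Submission where

open import Defs
open import Data.Bool using (Bool; true; false; not; _∧_; _∨_; if_then_else_; T?)
open import Data.Bool.ListAction using (all)
open import Data.Bool.Properties using (T-≡)
open import Data.Fin using (Fin; zero; suc; toℕ)
open import Data.Fin.Properties using (_≟_; toℕ-injective)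
open import Data.List using
  (List; []; _∷_; _++_; map; concatMap; length; filterᵇ; lookup; foldr; allFin; tabulate)
open import Data.List.Membership.Propositional using (_∈_)
open import Data.List.Membership.Propositional.Properties using (∈-lookup; ∈-allFin; ∈-filter⁻)
open import Data.List.Properties using (map-tabulate; map-++; map-∘; length-tabulate; tabulate-lookup)
open import Data.List.Relation.Unary.Any using (here; there)
open import Data.Nat using
  (ℕ; zero; suc; _+_; _*_; _^_; _≤_; _<_; _<ᵇ_; z≤n; z<s; NonZero; >-nonZero; ≢-nonZero; >-nonZero⁻¹)
open import Data.Nat.ListAction using (sum; product)
open import Data.Nat.ListAction.Properties using (sum-++)
open import Data.Nat.Properties hiding (_≟_)
open import Data.Nat.Tactic.RingSolver using (solve-∀)
open import Data.Product using (_×_; _,_; proj₁; proj₂; uncurry)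
open import Data.Sum using (inj₁; inj₂)
open import Function using (_∘_; it)
open import Function.Bundles using (module Equivalence)
open import Relation.Binary.PropositionalEquality
open import Relation.Nullary using (yes; no; contradiction)

-- Finite sums and products, and powers of natural numbers.

∑ ∏ : {A : Set} → List A → (A → ℕ) → ℕ
∑ xs f = sum (map f xs)
∏ xs f = product (map f xs)

^-distribʳ-* : ∀ a b n → (a * b) ^ n ≡ a ^ n * b ^ n
^-distribʳ-* a b zero    = refl
^-distribʳ-* a b (suc n) rewrite ^-distribʳ-* a b n = shuffle a b (a ^ n) (b ^ n)
  where
  shuffle : ∀ a b c d → a * b * (c * d) ≡ a * c * (b * d)
  shuffle = solve-∀

0^n≡0 : ∀ n .{{_ : NonZero n}} → 0 ^ n ≡ 0
0^n≡0 (suc n) = refl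

^-cancelʳ-≤ : ∀ n .{{_ : NonZero n}} {a b} → a ^ n ≤ b ^ n → a ≤ b
^-cancelʳ-≤ n aⁿ≤bⁿ = ≮⇒≥ λ b<a → <⇒≱ (^-monoˡ-< n b<a) aⁿ≤bⁿ

^-cancelʳ-< : ∀ n {a b} → a ^ n < b ^ n → a < b
^-cancelʳ-< n aⁿ<bⁿ = ≰⇒> λ b≤a → <⇒≱ aⁿ<bⁿ (^-monoˡ-≤ n b≤a)

-- To avoid subtraction, the larger number is written as the smaller plus `k`; the slack is then
-- exactly `k * k`.
2ab≤a²+b² : ∀ a b → 2 * a * b ≤ a * a + b * b
2ab≤a²+b² a b with ≤-total a b
... | inj₁ a≤b with k , refl ← m≤n⇒∃[o]m+o≡n a≤b =
    ≤-trans (m≤m+n _ (k * k)) (≤-reflexive (square a k))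
    where
    square : ∀ a k → 2 * a * (a + k) + k * k ≡ a * a + (a + k) * (a + k)
    square = solve-∀
... | inj₂ b≤a with k , refl ← m≤n⇒∃[o]m+o≡n b≤a =
    ≤-trans (m≤m+n _ (k * k)) (≤-reflexive (square b k))
    where
    square : ∀ b k → 2 * (b + k) * b + k * k ≡ (b + k) * (b + k) + b * b
    square = solve-∀

-- Root-free AM-GM and Hölder inequalities

-- Induction on `n`. Adding `n * a ^ suc n * t` to both sides makes the left side `suc n * a ^ n`
-- times `2 * a * t`. After `2ab≤a²+b²`, the part containing `t * t` is `t` times the left side of
-- the induction hypothesis.
young : ∀ n a t → suc n * a ^ n * t ≤ t ^ suc n + n * a ^ suc n
young zero    a t = ≤-reflexive (base t)
  where
  base : ∀ t → 1 * 1 * t ≡ t * 1 + 0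
  base = solve-∀
young (suc n) a t = +-cancelʳ-≤ (n * a * A * t) _ _ (begin
  suc (suc n) * (a * A) * t + n * a * A * t              ≡⟨ lhs n a A t ⟩
  suc n * A * (2 * a * t)                                ≤⟨ *-monoʳ-≤ (suc n * A) (2ab≤a²+b² a t) ⟩
  suc n * A * (a * a + t * t)                            ≡⟨ mid n a A t ⟩
  t * (suc n * A * t) + suc n * (a * (a * A))            ≤⟨ +-monoˡ-≤ _ (*-monoʳ-≤ t (young n a t)) ⟩
  t * (t * T + n * (a * A)) + suc n * (a * (a * A))      ≡⟨ rhs n a A t T ⟩
  t * (t * T) + suc n * (a * (a * A)) + n * a * A * t    ∎)
  where
  open ≤-Reasoning
  A = a ^ n
  T = t ^ n
  lhs : ∀ n a A t → suc (suc n) * (a * A) * t + n * a * A * t ≡ suc n * A * (2 * a * t)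
  lhs = solve-∀
  mid : ∀ n a A t → suc n * A * (a * a + t * t) ≡ t * (suc n * A * t) + suc n * (a * (a * A))
  mid = solve-∀
  rhs : ∀ n a A t T → t * (t * T + n * (a * A)) + suc n * (a * (a * A))
      ≡ t * (t * T) + suc n * (a * (a * A)) + n * a * A * t
  rhs = solve-∀

-- AM-GM for `n` copies of `S / n` and one `y`, with denominators cleared. It is `young` at
-- `a = suc n * S` and `t = n * (S + y)`. A spare factor `n` is cancelled at the end, so `n = 0` is
-- treated apart.
weighted-AM-GM : ∀ n S y → suc n ^ suc n * S ^ n * y ≤ n ^ n * (S + y) ^ suc n
weighted-AM-GM zero    S y = subst₂ _≤_ (lhs y) (rhs S y) (m≤n+m y S)
  where
  lhs : ∀ y → y ≡ 1 * 1 * y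
  lhs = solve-∀
  rhs : ∀ S y → S + y ≡ 1 * ((S + y) * 1)
  rhs = solve-∀
weighted-AM-GM n@(suc _) S y = *-cancelˡ-≤ n (+-cancelʳ-≤ (n * (N * S) ^ N) _ _ (begin
  n * (N ^ N * S ^ n * y) + n * (N * S) ^ N
    ≡⟨ cong (λ z → n * (N ^ N * S ^ n * y) + n * z) (^-distribʳ-* N S N) ⟩
  n * (N ^ N * S ^ n * y) + n * (N ^ N * S ^ N)
    ≡⟨ lhs n N (N ^ n) S (S ^ n) y ⟩
  N * (N ^ n * S ^ n) * (n * (S + y))
    ≡⟨ cong (λ z → N * z * (n * (S + y))) (sym (^-distribʳ-* N S n)) ⟩
  N * (N * S) ^ n * (n * (S + y))
    ≤⟨ young n (N * S) (n * (S + y)) ⟩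
  (n * (S + y)) ^ N + n * (N * S) ^ N
    ≡⟨ cong (_+ n * (N * S) ^ N) (trans (^-distribʳ-* n (S + y) N) (*-assoc n (n ^ n) _)) ⟩
  n * (n ^ n * (S + y) ^ N) + n * (N * S) ^ N ∎))
  where
  open ≤-Reasoning
  N = suc n
  lhs : ∀ n N P S T y → n * (N * P * T * y) + n * (N * P * (S * T)) ≡ N * (P * T) * (n * (S + y))
  lhs = solve-∀

-- ∑ᵢ wᵢ ∏_{j≠i} sⱼ, that is, ∑ᵢ wᵢ/sᵢ over the common denominator ∏ᵢ sᵢ.
crossSum : {A : Set} → (A → ℕ) → (A → ℕ) → List A → ℕ
crossSum s w []       = 0
crossSum s w (x ∷ xs) = w x * ∏ xs s + s x * crossSum s w xs

-- AM-GM for the fractions wᵢ/sᵢ, with denominators cleared.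
AM-GM : {A : Set} (s w : A → ℕ) (xs : List A) → let n = length xs in
  n ^ n * ∏ xs w * ∏ xs s ^ n ≤ crossSum s w xs ^ n * ∏ xs s
AM-GM s w []       = ≤-refl
-- The factor `n ^ n` makes room for the induction hypothesis on `xs`. It can be cancelled even for
-- an empty tail, since `0 ^ 0` is 1.
AM-GM s w (x ∷ xs) = *-cancelˡ-≤ (n ^ n) {{m^m≢0 n}} (begin
  n ^ n * (N ^ N * (w x * P) * (s x * Q) ^ N)
    ≡⟨ cong (λ z → n ^ n * (N ^ N * (w x * P) * z)) (^-distribʳ-* (s x) Q N) ⟩
  n ^ n * (N ^ N * (w x * P) * (s x * s x ^ n * (Q * Q ^ n)))
    ≡⟨ lhs (n ^ n) (N ^ N) (w x) P (s x) (s x ^ n) Q (Q ^ n) ⟩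
  N ^ N * w x * s x * s x ^ n * Q * (n ^ n * P * Q ^ n)
    ≤⟨ *-monoʳ-≤ (N ^ N * w x * s x * s x ^ n * Q) (AM-GM s w xs) ⟩
  N ^ N * w x * s x * s x ^ n * Q * (E ^ n * Q)
    ≡⟨ mid (N ^ N) (w x) (s x) (s x ^ n) Q (E ^ n) ⟩
  N ^ N * (s x ^ n * E ^ n) * (w x * Q) * (s x * Q)
    ≡⟨ cong (λ z → N ^ N * z * (w x * Q) * (s x * Q)) (sym (^-distribʳ-* (s x) E n)) ⟩
  N ^ N * (s x * E) ^ n * (w x * Q) * (s x * Q)
    -- Over the common denominator `s x * Q`, the fractions of the tail add up to `s x * E` and the
    -- head fraction is `w x * Q`.
    ≤⟨ *-monoˡ-≤ (s x * Q) (weighted-AM-GM n (s x * E) (w x * Q)) ⟩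
  n ^ n * (s x * E + w x * Q) ^ N * (s x * Q)
    ≡⟨ cong (λ z → n ^ n * z ^ N * (s x * Q)) (+-comm (s x * E) (w x * Q)) ⟩
  n ^ n * (w x * Q + s x * E) ^ N * (s x * Q)
    ≡⟨ *-assoc (n ^ n) _ _ ⟩
  n ^ n * ((w x * Q + s x * E) ^ N * (s x * Q)) ∎)
  where
  open ≤-Reasoning
  n = length xs
  N = suc n
  P = ∏ xs w
  Q = ∏ xs s
  E = crossSum s w xs
  m^m≢0 : ∀ m → NonZero (m ^ m)
  m^m≢0 zero    = _
  m^m≢0 (suc m) = m^n≢0 (suc m) (suc m)
  lhs : ∀ a b w P s t Q R → a * (b * (w * P) * (s * t * (Q * R))) ≡ b * w * s * t * Q * (a * P * R)
  lhs = solve-∀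
  mid : ∀ b w s t Q F → b * w * s * t * Q * (F * Q) ≡ b * (t * F) * (w * Q) * (s * Q)
  mid = solve-∀

-- Laws of finite sums and products.

module _ {A : Set} where

  ∑-cong : ∀ {f g : A → ℕ} → (∀ x → f x ≡ g x) → ∀ xs → ∑ xs f ≡ ∑ xs g
  ∑-cong f≗g []       = refl
  ∑-cong f≗g (x ∷ xs) = cong₂ _+_ (f≗g x) (∑-cong f≗g xs)

  ∏-cong : ∀ {f g : A → ℕ} → (∀ x → f x ≡ g x) → ∀ xs → ∏ xs f ≡ ∏ xs g
  ∏-cong f≗g []       = refl
  ∏-cong f≗g (x ∷ xs) = cong₂ _*_ (f≗g x) (∏-cong f≗g xs)

  ∑-zero : ∀ {f : A → ℕ} xs → (∀ {x} → x ∈ xs → f x ≡ 0) → ∑ xs f ≡ 0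
  ∑-zero []       f≗0 = refl
  ∑-zero (x ∷ xs) f≗0 = cong₂ _+_ (f≗0 (here refl)) (∑-zero xs (f≗0 ∘ there))

  ∈⇒≤∑ : ∀ (f : A → ℕ) {x xs} → x ∈ xs → f x ≤ ∑ xs f
  ∈⇒≤∑ f (here refl)           = m≤m+n _ _
  ∈⇒≤∑ f (there {x = y} x∈xs) = ≤-trans (∈⇒≤∑ f x∈xs) (m≤n+m _ (f y))

  ∑-distrib-+ : ∀ (f g : A → ℕ) xs → ∑ xs (λ x → f x + g x) ≡ ∑ xs f + ∑ xs g
  ∑-distrib-+ f g []       = refl
  ∑-distrib-+ f g (x ∷ xs) rewrite ∑-distrib-+ f g xs = shuffle (f x) (g x) (∑ xs f) (∑ xs g)
    where
    shuffle : ∀ a b c d → a + b + (c + d) ≡ a + c + (b + d)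
    shuffle = solve-∀

  *-distribˡ-∑ : ∀ c (f : A → ℕ) xs → ∑ xs (λ x → c * f x) ≡ c * ∑ xs f
  *-distribˡ-∑ c f []       = sym (*-zeroʳ c)
  *-distribˡ-∑ c f (x ∷ xs) rewrite *-distribˡ-∑ c f xs = sym (*-distribˡ-+ c (f x) (∑ xs f))

  *-distribʳ-∑ : ∀ c (f : A → ℕ) xs → ∑ xs (λ x → f x * c) ≡ ∑ xs f * c
  *-distribʳ-∑ c f []       = refl
  *-distribʳ-∑ c f (x ∷ xs) rewrite *-distribʳ-∑ c f xs = sym (*-distribʳ-+ c (f x) (∑ xs f))

  ∑-mono-≤ : ∀ {f g : A → ℕ} → (∀ x → f x ≤ g x) → ∀ xs → ∑ xs f ≤ ∑ xs g
  ∑-mono-≤ f≤g []       = z≤n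
  ∑-mono-≤ f≤g (x ∷ xs) = +-mono-≤ (f≤g x) (∑-mono-≤ f≤g xs)

  -- Strictness is asked only where `h` is positive, and the positive sum of `h` supplies such a
  -- place. In `hölder` the role of `h` is played by the cross sum.
  ∑-mono-< : ∀ {f g h : A → ℕ} → (∀ x → f x ≤ g x) → (∀ x → 0 < h x → f x < g x) →
    ∀ xs → 0 < ∑ xs h → ∑ xs f < ∑ xs g
  ∑-mono-< {h = h} f≤g f<g (x ∷ xs) 0<∑h with h x in hx
  ... | zero  = +-mono-≤-< (f≤g x) (∑-mono-< f≤g f<g xs 0<∑h)
  ... | suc _ = +-mono-<-≤ (f<g x (subst (0 <_) (sym hx) z<s)) (∑-mono-≤ f≤g xs)

  ∏-mono-≤ : ∀ {f g : A → ℕ} → (∀ x → f x ≤ g x) → ∀ xs → ∏ xs f ≤ ∏ xs g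
  ∏-mono-≤ f≤g []       = ≤-refl
  ∏-mono-≤ f≤g (x ∷ xs) = *-mono-≤ (f≤g x) (∏-mono-≤ f≤g xs)

  ∏-^ : ∀ (f : A → ℕ) n xs → ∏ xs f ^ n ≡ ∏ xs (λ x → f x ^ n)
  ∏-^ f n []       = ^-zeroˡ n
  ∏-^ f n (x ∷ xs) = trans (^-distribʳ-* (f x) (∏ xs f) n) (cong (f x ^ n *_) (∏-^ f n xs))

  ∏-const : ∀ c (xs : List A) → ∏ xs (λ _ → c) ≡ c ^ length xs
  ∏-const c []       = refl
  ∏-const c (x ∷ xs) = cong (c *_) (∏-const c xs)

-- Interchange of sums and Hölder's inequality.

module _ {A X : Set} where

  ∑-comm : ∀ (f : A → X → ℕ) xs ys → ∑ xs (λ x → ∑ ys (f x)) ≡ ∑ ys (λ y → ∑ xs (λ x → f x y))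
  ∑-comm f []       ys = sym (∑-zero ys (λ _ → refl))
  ∑-comm f (x ∷ xs) ys rewrite ∑-comm f xs ys = sym (∑-distrib-+ (f x) (λ y → ∑ xs (λ z → f z y)) ys)

  module _ (W : A → X → ℕ) (ys : List X) where

    total : A → ℕ
    total b = ∑ ys (W b)

    -- Summing over `y` turns the single factor `W b y` of each term into `total b`, so each of the
    -- `length L` terms becomes the full product.
    ∑-crossSum : ∀ L → ∑ ys (λ y → crossSum total (λ b → W b y) L) ≡ length L * ∏ L total
    ∑-crossSum []      = ∑-zero ys (λ _ → refl)
    ∑-crossSum (b ∷ L) = begin
      ∑ ys (λ y → W b y * Q + total b * E y)
        ≡⟨ ∑-distrib-+ _ _ ys ⟩
      ∑ ys (λ y → W b y * Q) + ∑ ys (λ y → total b * E y)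
        ≡⟨ cong₂ _+_ (*-distribʳ-∑ Q (W b) ys) (*-distribˡ-∑ (total b) E ys) ⟩
      total b * Q + total b * ∑ ys E
        ≡⟨ cong (λ z → total b * Q + total b * z) (∑-crossSum L) ⟩
      total b * Q + total b * (length L * Q)
        ≡⟨ factor (total b) Q (length L) ⟩
      suc (length L) * (total b * Q)                         ∎
      where
      open ≡-Reasoning
      Q = ∏ L total
      E = λ y → crossSum total (λ b → W b y) L
      factor : ∀ t Q n → t * Q + t * (n * Q) ≡ suc n * (t * Q)
      factor = solve-∀

    -- Hölder's inequality in root-free form. If P = ∑ F satisfied Pⁿ > C Q with Q = ∏ total,
    -- then AM-GM would give n F(y) Q ≤ P E(y), strictly whenever the cross sum E(y) is
    -- positive, and summing over y would give n P Q < P n Q.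
    hölder : ∀ C L .{{_ : NonZero (length L)}} (F : X → ℕ) →
      (∀ y → F y ^ length L ≤ C * ∏ L (λ b → W b y)) →
      ∑ ys F ^ length L ≤ C * ∏ L total
    hölder C L F F≤W = ≮⇒≥ λ CQ<Pⁿ → <-irrefl refl (absurd CQ<Pⁿ)
      where
      n = length L
      P = ∑ ys F
      Q = ∏ L total
      E : X → ℕ
      E y = crossSum total (λ b → W b y) L

      open ≤-Reasoning

      pointwise : ∀ y → (n * Q * F y) ^ n ≤ C * Q * E y ^ n
      pointwise y = begin
        (n * Q * F y) ^ n                        ≡⟨ ^-distribʳ-* (n * Q) (F y) n ⟩
        (n * Q) ^ n * F y ^ n                    ≡⟨ cong (_* F y ^ n) (^-distribʳ-* n Q n) ⟩
        n ^ n * Q ^ n * F y ^ n                  ≤⟨ *-monoʳ-≤ (n ^ n * Q ^ n) (F≤W y) ⟩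
        n ^ n * Q ^ n * (C * ∏ L (λ b → W b y))  ≡⟨ lhs (n ^ n) (Q ^ n) C (∏ L (λ b → W b y)) ⟩
        C * (n ^ n * ∏ L (λ b → W b y) * Q ^ n)  ≤⟨ *-monoʳ-≤ C (AM-GM total (λ b → W b y) L) ⟩
        C * (E y ^ n * Q)                        ≡⟨ rhs C (E y ^ n) Q ⟩
        C * Q * E y ^ n                          ∎
        where
        lhs : ∀ a b C w → a * b * (C * w) ≡ C * (a * w * b)
        lhs = solve-∀
        rhs : ∀ C e Q → C * (e * Q) ≡ C * Q * e
        rhs = solve-∀

      module _ (CQ<Pⁿ : C * Q < P ^ n) where

        weak-step : ∀ y → n * Q * F y ≤ P * E y
        weak-step y = ^-cancelʳ-≤ n (begin
          (n * Q * F y) ^ n   ≤⟨ pointwise y ⟩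
          C * Q * E y ^ n     ≤⟨ *-monoˡ-≤ (E y ^ n) (<⇒≤ CQ<Pⁿ) ⟩
          P ^ n * E y ^ n     ≡⟨ sym (^-distribʳ-* P (E y) n) ⟩
          (P * E y) ^ n       ∎)

        strict-step : ∀ y → 0 < E y → n * Q * F y < P * E y
        strict-step y 0<E = ^-cancelʳ-< n (begin-strict
          (n * Q * F y) ^ n   ≤⟨ pointwise y ⟩
          C * Q * E y ^ n     <⟨ *-monoˡ-< (E y ^ n) {{m^n≢0 (E y) n {{>-nonZero 0<E}}}} CQ<Pⁿ ⟩
          P ^ n * E y ^ n     ≡⟨ sym (^-distribʳ-* P (E y) n) ⟩
          (P * E y) ^ n       ∎)

        absurd : n * Q * P < n * Q * P
        absurd = begin-strict
          n * Q * P                   ≡⟨ sym (*-distribˡ-∑ (n * Q) F ys) ⟩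
          ∑ ys (λ y → n * Q * F y)    <⟨ ∑-mono-< weak-step strict-step ys 0<∑E ⟩
          ∑ ys (λ y → P * E y)        ≡⟨ *-distribˡ-∑ P E ys ⟩
          P * ∑ ys E                  ≡⟨ cong (P *_) (∑-crossSum L) ⟩
          P * (n * Q)                 ≡⟨ *-comm P (n * Q) ⟩
          n * Q * P                   ∎
          where
          Q≢0 : Q ≢ 0
          -- Every `W b y` with `y ∈ ys` is at most `total b`. If `Q` were 0, then `F` would vanish
          -- on `ys`, so `P ^ n` would be 0 and could not exceed `C * Q`.
          Q≢0 Q≡0 = <⇒≢ (≤-<-trans z≤n CQ<Pⁿ) (sym (trans (cong (_^ n) (∑-zero ys F≡0)) (0^n≡0 n)))
            where
            F≡0 : ∀ {y} → y ∈ ys → F y ≡ 0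
            F≡0 {y} y∈ys = m^n≡0⇒m≡0 (F y) n (n≤0⇒n≡0 (begin
              F y ^ n                  ≤⟨ F≤W y ⟩
              C * ∏ L (λ b → W b y)    ≤⟨ *-monoʳ-≤ C (∏-mono-≤ (λ b → ∈⇒≤∑ (W b) y∈ys) L) ⟩
              C * Q                    ≡⟨ cong (C *_) Q≡0 ⟩
              C * 0                    ≡⟨ *-zeroʳ C ⟩
              0                        ∎))
          0<∑E : 0 < ∑ ys E
          0<∑E = subst (0 <_) (sym (∑-crossSum L))
            (>-nonZero⁻¹ (n * Q) {{m*n≢0 n Q {{it}} {{≢-nonZero Q≢0}}}})

-- Indicators, and sums over lists and over functions.

⟦_⟧ : Bool → ℕ
⟦ b ⟧ = if b then 1 else 0

module _ {A : Set} where

  ∑-++ : ∀ (f : A → ℕ) xs ys → ∑ (xs ++ ys) f ≡ ∑ xs f + ∑ ys f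
  ∑-++ f xs ys = trans (cong sum (map-++ f xs ys)) (sum-++ (map f xs) (map f ys))

  ∑-filterᵇ : ∀ p (f : A → ℕ) xs → ∑ (filterᵇ p xs) f ≡ ∑ xs (λ x → ⟦ p x ⟧ * f x)
  ∑-filterᵇ p f []       = refl
  ∑-filterᵇ p f (x ∷ xs) with p x
  ... | true  = cong₂ _+_ (sym (+-identityʳ (f x))) (∑-filterᵇ p f xs)
  ... | false = ∑-filterᵇ p f xs

  length-filterᵇ : ∀ p (xs : List A) → length (filterᵇ p xs) ≡ ∑ xs (λ x → ⟦ p x ⟧)
  length-filterᵇ p []       = refl
  length-filterᵇ p (x ∷ xs) with p x
  ... | true  = cong suc (length-filterᵇ p xs)
  ... | false = length-filterᵇ p xs

  ∑-lookup : ∀ (f : A → ℕ) xs → ∑ (allFin (length xs)) (f ∘ lookup xs) ≡ ∑ xs f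
  ∑-lookup f xs = cong sum (begin
    map (f ∘ lookup xs) (allFin (length xs))    ≡⟨ map-∘ (allFin (length xs)) ⟩
    map f (map (lookup xs) (allFin (length xs))) ≡⟨ cong (map f) (map-tabulate (λ i → i) (lookup xs)) ⟩
    map f (tabulate (lookup xs))                ≡⟨ cong (map f) (tabulate-lookup xs) ⟩
    map f xs                                    ∎)
    where open ≡-Reasoning

  ∏-if : ∀ (s : A → Bool) (V c : A → ℕ) xs →
    ∏ xs (λ b → if s b then V b else c b) ≡ ∏ xs (λ b → if s b then 1 else c b) * ∏ (filterᵇ s xs) V
  ∏-if s V c []       = refl
  ∏-if s V c (b ∷ xs) with s b
  ... | true  = trans (cong (V b *_) (∏-if s V c xs))
    (shuffle (V b) (∏ xs (λ b → if s b then 1 else c b)) (∏ (filterᵇ s xs) V))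
    where
    shuffle : ∀ v c w → v * (c * w) ≡ 1 * c * (v * w)
    shuffle = solve-∀
  ... | false = trans (cong (c b *_) (∏-if s V c xs)) (sym (*-assoc (c b) _ _))

module _ {A B : Set} where

  ∑-map : ∀ (f : B → ℕ) (g : A → B) xs → ∑ (map g xs) f ≡ ∑ xs (f ∘ g)
  ∑-map f g xs = cong sum (sym (map-∘ xs))

  ∑-concatMap : ∀ (f : B → ℕ) (g : A → List B) xs → ∑ (concatMap g xs) f ≡ ∑ xs (λ x → ∑ (g x) f)
  ∑-concatMap f g []       = refl
  ∑-concatMap f g (x ∷ xs) = trans (∑-++ f (g x) _) (cong (∑ (g x) f +_) (∑-concatMap f g xs))

map-allFin-suc : ∀ {A : Set} {n} (f : Fin (suc n) → A) →
  map f (allFin (suc n)) ≡ f zero ∷ map (f ∘ suc) (allFin n)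
map-allFin-suc f = cong (f zero ∷_) (trans (map-tabulate suc f) (sym (map-tabulate (λ i → i) (f ∘ suc))))

∑-allFin-suc : ∀ {n} (f : Fin (suc n) → ℕ) → ∑ (allFin (suc n)) f ≡ f zero + ∑ (allFin n) (f ∘ suc)
∑-allFin-suc f = cong sum (map-allFin-suc f)

∏-allFin-suc : ∀ {n} (f : Fin (suc n) → ℕ) → ∏ (allFin (suc n)) f ≡ f zero * ∏ (allFin n) (f ∘ suc)
∏-allFin-suc f = cong product (map-allFin-suc f)

∑-allFuns-suc : ∀ {n k} (F : (Fin (suc n) → Fin k) → ℕ) →
  ∑ (allFuns (suc n) k) F ≡ ∑ (allFin k) (λ a → ∑ (allFuns n k) (F ∘ cons a))
∑-allFuns-suc {n} {k} F = trans
  (∑-concatMap F (λ a → map (cons a) (allFuns n k)) (allFin k))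
  (∑-cong (λ a → ∑-map F (cons a) (allFuns n k)) (allFin k))

-- Distributivity: the values `r j` are chosen independently. This is what sums out one half of the
-- double cover vertex by vertex.
∑-allFuns-∏ : ∀ {n k} (g : Fin n → Fin k → ℕ) →
  ∑ (allFuns n k) (λ r → ∏ (allFin n) (λ j → g j (r j))) ≡ ∏ (allFin n) (λ j → ∑ (allFin k) (g j))
∑-allFuns-∏ {zero}      g = refl
∑-allFuns-∏ {suc n} {k} g = begin
  ∑ (allFuns (suc n) k) (λ r → ∏ (allFin (suc n)) (λ j → g j (r j)))
    ≡⟨ ∑-allFuns-suc {n} {k} (λ r → ∏ (allFin (suc n)) (λ j → g j (r j))) ⟩
  ∑ (allFin k) (λ v → ∑ (allFuns n k) (λ r → ∏ (allFin (suc n)) (λ j → g j (cons v r j))))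
    ≡⟨ ∑-cong (λ v → ∑-cong (λ r → ∏-allFin-suc (λ j → g j (cons v r j))) (allFuns n k)) (allFin k) ⟩
  ∑ (allFin k) (λ v → ∑ (allFuns n k) (λ r → g zero v * ∏ (allFin n) (λ j → g (suc j) (r j))))
    ≡⟨ ∑-cong (λ v → *-distribˡ-∑ (g zero v) _ (allFuns n k)) (allFin k) ⟩
  ∑ (allFin k) (λ v → g zero v * ∑ (allFuns n k) (λ r → ∏ (allFin n) (λ j → g (suc j) (r j))))
    ≡⟨ *-distribʳ-∑ _ (g zero) (allFin k) ⟩
  ∑ (allFin k) (g zero) * ∑ (allFuns n k) (λ r → ∏ (allFin n) (λ j → g (suc j) (r j)))
    ≡⟨ cong (∑ (allFin k) (g zero) *_) (∑-allFuns-∏ (g ∘ suc)) ⟩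
  ∑ (allFin k) (g zero) * ∏ (allFin n) (λ j → ∑ (allFin k) (g (suc j)))
    ≡⟨ sym (∏-allFin-suc (λ j → ∑ (allFin k) (g j))) ⟩
  ∏ (allFin (suc n)) (λ j → ∑ (allFin k) (g j)) ∎
  where open ≡-Reasoning

-- Finner's inequality

-- A restriction is encoded as the list of selected values in index order. Fixing coordinate zero
-- then just puts an entry in front, in step with the recursion of `∑Lists` and the induction in
-- `finner`.
restrict : ∀ {n} {A : Set} → (Fin n → Bool) → (Fin n → A) → List A
restrict {zero}  s f = []
restrict {suc n} s f =
  if s zero then f zero ∷ restrict (s ∘ suc) (f ∘ suc) else restrict (s ∘ suc) (f ∘ suc)

count : ∀ {n} → (Fin n → Bool) → ℕ
count {n} s = length (filterᵇ s (allFin n))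

count≡∑ : ∀ {n} (s : Fin n → Bool) → count s ≡ ∑ (allFin n) (λ i → ⟦ s i ⟧)
count≡∑ {n} s = length-filterᵇ s (allFin n)

count-suc : ∀ {n} (s : Fin (suc n) → Bool) → count s ≡ ⟦ s zero ⟧ + count (s ∘ suc)
count-suc s = trans (count≡∑ s) (trans (∑-allFin-suc (λ i → ⟦ s i ⟧))
  (cong (⟦ s zero ⟧ +_) (sym (count≡∑ (s ∘ suc)))))

∑Lists : ∀ {k} → ℕ → (List (Fin k) → ℕ) → ℕ
∑Lists     zero    W = W []
∑Lists {k} (suc c) W = ∑ (allFin k) (λ x → ∑Lists c (W ∘ (x ∷_)))

-- The factors with `s b` false do not depend on `y` and are absorbed into the constant `C` of
-- `hölder`. The `D` others form its list, whose length is the exponent.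
hölder-masked : ∀ {B X : Set} (xs : List B) (ys : List X) (s : B → Bool) D .{{_ : NonZero D}} →
  length (filterᵇ s xs) ≡ D → (F : X → ℕ) (V : B → X → ℕ) (c : B → ℕ) →
  (∀ y → F y ^ D ≤ ∏ xs (λ b → if s b then V b y else c b)) →
  ∑ ys F ^ D ≤ ∏ xs (λ b → if s b then ∑ ys (V b) else c b)
hölder-masked xs ys s _ refl F V c F≤V =
  subst (∑ ys F ^ length (filterᵇ s xs) ≤_) (sym (∏-if s _ c xs))
    (hölder V ys (∏ xs (λ b → if s b then 1 else c b)) (filterᵇ s xs) F
      (λ y → subst (F y ^ length (filterᵇ s xs) ≤_) (∏-if s _ c xs) (F≤V y)))

-- `M a b` says that coordinate `a` lies in the set indexed by `b`; each coordinate lies in exactly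
-- `D` sets. Induction on the number of coordinates: for each fixed value `x` of the first one, the
-- induction hypothesis bounds the slice by a product in which only the `D` factors with `M zero b`
-- involve `x`. Then `hölder-masked` sums over `x`.
finner : ∀ {B : Set} (xs : List B) D .{{_ : NonZero D}} {n k} (M : Fin n → B → Bool) →
  (∀ a → length (filterᵇ (M a) xs) ≡ D) →
  (F : (Fin n → Fin k) → ℕ) (W : B → List (Fin k) → ℕ) →
  (∀ f → F f ^ D ≤ ∏ xs (λ b → W b (restrict (λ a → M a b) f))) →
  ∑ (allFuns n k) F ^ D ≤ ∏ xs (λ b → ∑Lists (count (λ a → M a b)) (W b))
finner xs D {zero}      M regular F W F≤W = subst (λ z → z ^ D ≤ _) (sym (+-identityʳ _)) (F≤W _)
finner {B} xs D {suc n} {k} M regular F W F≤W = begin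
  ∑ (allFuns (suc n) k) F ^ D
    ≡⟨ cong (_^ D) (∑-allFuns-suc F) ⟩
  ∑ (allFin k) (λ x → ∑ (allFuns n k) (F ∘ cons x)) ^ D
    ≤⟨ hölder-masked xs (allFin k) (M zero) D (regular zero) _ _ _ slice ⟩
  ∏ xs (λ b → if M zero b then ∑ (allFin k) (λ x → ∑Lists (c b) (W b ∘ (x ∷_))) else ∑Lists (c b) (W b))
    ≡⟨ ∏-cong collect xs ⟩
  ∏ xs (λ b → ∑Lists (count (λ a → M a b)) (W b)) ∎
  where
  open ≤-Reasoning
  c : B → ℕ
  c b = count (λ a → M (suc a) b)

  Wₓ : Fin k → B → List (Fin k) → ℕ
  Wₓ x b l = if M zero b then W b (x ∷ l) else W b l

  ∑Lists-if : ∀ x b → ∑Lists (c b) (Wₓ x b)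
    ≡ (if M zero b then ∑Lists (c b) (W b ∘ (x ∷_)) else ∑Lists (c b) (W b))
  ∑Lists-if x b with M zero b
  ... | true  = refl
  ... | false = refl

  restrict-if : ∀ x f b → W b (restrict (λ a → M a b) (cons x f)) ≡ Wₓ x b (restrict (λ a → M (suc a) b) f)
  restrict-if x f b with M zero b
  ... | true  = refl
  ... | false = refl

  slice : ∀ x → ∑ (allFuns n k) (F ∘ cons x) ^ D
    ≤ ∏ xs (λ b → if M zero b then ∑Lists (c b) (W b ∘ (x ∷_)) else ∑Lists (c b) (W b))
  slice x = subst (_ ≤_) (∏-cong (∑Lists-if x) xs)
    (finner xs D (M ∘ suc) (regular ∘ suc) (F ∘ cons x) (Wₓ x)
      (λ f → subst (_ ≤_) (∏-cong (restrict-if x f) xs) (F≤W (cons x f))))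

  collect : ∀ b → (if M zero b then ∑ (allFin k) (λ x → ∑Lists (c b) (W b ∘ (x ∷_))) else ∑Lists (c b) (W b))
    ≡ ∑Lists (count (λ a → M a b)) (W b)
  collect b rewrite count-suc (λ a → M a b) with M zero b
  ... | true  = refl
  ... | false = refl

-- Boolean tests for lists, restrictions and homomorphisms.

bool-ext : ∀ {a b} → (a ≡ true → b ≡ true) → (b ≡ true → a ≡ true) → a ≡ b
bool-ext {true}  {true}  f g = refl
bool-ext {true}  {false} f g = sym (f refl)
bool-ext {false} {true}  f g = g refl
bool-ext {false} {false} f g = refl

∧-true : ∀ {a b} → a ∧ b ≡ true → a ≡ true × b ≡ true
∧-true {true} b≡true = refl , b≡true

≢true⇒≡false : ∀ {b} → b ≢ true → b ≡ false
≢true⇒≡false {true}  b≢true = contradiction refl b≢true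
≢true⇒≡false {false} _      = refl

module _ {A : Set} (p : A → Bool) where

  ⟦all⟧ : ∀ xs → ⟦ all p xs ⟧ ≡ ∏ xs (λ x → ⟦ p x ⟧)
  ⟦all⟧ []       = refl
  ⟦all⟧ (x ∷ xs) with p x
  ... | true  = trans (⟦all⟧ xs) (sym (+-identityʳ _))
  ... | false = refl

  foldr-∧⇒ : ∀ {xs} → foldr (λ i acc → p i ∧ acc) true xs ≡ true → ∀ {x} → x ∈ xs → p x ≡ true
  foldr-∧⇒ {_ ∷ _} eq (here refl)  = proj₁ (∧-true eq)
  foldr-∧⇒ {_ ∷ _} eq (there x∈xs) = foldr-∧⇒ (proj₂ (∧-true eq)) x∈xs

  foldr-∧⇐ : ∀ xs → (∀ x → p x ≡ true) → foldr (λ i acc → p i ∧ acc) true xs ≡ true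
  foldr-∧⇐ []       h = refl
  foldr-∧⇐ (x ∷ xs) h = cong₂ _∧_ (h x) (foldr-∧⇐ xs h)

  all≡foldr : ∀ xs → all p xs ≡ foldr (λ i acc → p i ∧ acc) true xs
  all≡foldr []       = refl
  all≡foldr (x ∷ xs) = cong (p x ∧_) (all≡foldr xs)

all-allFin⇒ : ∀ {n} (p : Fin n → Bool) → all p (allFin n) ≡ true → ∀ i → p i ≡ true
all-allFin⇒ {n} p eq i = foldr-∧⇒ p (trans (sym (all≡foldr p (allFin n))) eq) (∈-allFin i)

all-allFin⇐ : ∀ {n} (p : Fin n → Bool) → (∀ i → p i ≡ true) → all p (allFin n) ≡ true
all-allFin⇐ {n} p h = trans (all≡foldr p (allFin n)) (foldr-∧⇐ p (allFin n) h)

all-restrict⇒ : ∀ {n} {A : Set} (p : A → Bool) (s : Fin n → Bool) f →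
  all p (restrict s f) ≡ true → ∀ i → s i ≡ true → p (f i) ≡ true
all-restrict⇒ {suc n} p s f eq i si with s zero in s0
all-restrict⇒ p s f eq zero    si | true  = proj₁ (∧-true eq)
all-restrict⇒ {suc n} p s f eq (suc i) si | true  = all-restrict⇒ p (s ∘ suc) (f ∘ suc) (proj₂ (∧-true eq)) i si
all-restrict⇒ p s f eq zero    si | false = contradiction (trans (sym s0) si) λ ()
all-restrict⇒ {suc n} p s f eq (suc i) si | false = all-restrict⇒ p (s ∘ suc) (f ∘ suc) eq i si

all-restrict⇐ : ∀ {n} {A : Set} (p : A → Bool) (s : Fin n → Bool) f →
  (∀ i → s i ≡ true → p (f i) ≡ true) → all p (restrict s f) ≡ true
all-restrict⇐ {zero}  p s f h = refl
all-restrict⇐ {suc n} p s f h with s zero in s0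
... | true  = cong₂ _∧_ (h zero s0) (all-restrict⇐ p (s ∘ suc) (f ∘ suc) (h ∘ suc))
... | false = all-restrict⇐ p (s ∘ suc) (f ∘ suc) (h ∘ suc)

isHom⇒ : ∀ {n k} (G : Graph n) (H : Graph k) f → isHom G H f ≡ true →
  ∀ i j → G i j ≡ true → H (f i) (f j) ≡ true
isHom⇒ G H f eq i j Gij = subst (λ g → not g ∨ H (f i) (f j) ≡ true) Gij
  (foldr-∧⇒ _ (foldr-∧⇒ _ eq (∈-allFin i)) (∈-allFin j))

isHom⇐ : ∀ {n k} (G : Graph n) (H : Graph k) f →
  (∀ i j → G i j ≡ true → H (f i) (f j) ≡ true) → isHom G H f ≡ true
isHom⇐ {n} G H f h = foldr-∧⇐ _ (allFin n) λ i → foldr-∧⇐ _ (allFin n) (preserved i)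
  where
  preserved : ∀ i j → not (G i j) ∨ H (f i) (f j) ≡ true
  preserved i j with G i j in Gij
  ... | true  = h i j Gij
  ... | false = refl

-- The equality test and closed neighbourhoods.

==⇒≡ : ∀ {n} {i j : Fin n} → (i == j) ≡ true → i ≡ j
==⇒≡ {i = i} {j} eq with i ≟ j
... | yes i≡j = i≡j

==-refl : ∀ {n} (i : Fin n) → (i == i) ≡ true
==-refl i with i ≟ i
... | yes _  = refl
... | no i≢i = contradiction refl i≢i

==-sym : ∀ {n} (i j : Fin n) → (i == j) ≡ (j == i)
==-sym i j = bool-ext (λ i=j → subst (λ z → (z == i) ≡ true) (==⇒≡ {i = i} i=j) (==-refl i))
                      (λ j=i → subst (λ z → (z == j) ≡ true) (==⇒≡ {i = j} j=i) (==-refl j))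

∑-== : ∀ {n} (i : Fin n) → ∑ (allFin n) (λ j → ⟦ i == j ⟧) ≡ 1
∑-== {suc n} zero    = trans (∑-allFin-suc {n} (λ j → ⟦ zero == j ⟧)) (cong suc (∑-zero (allFin n) λ _ → refl))
∑-== {suc n} (suc i) = trans (∑-allFin-suc (λ j → ⟦ suc i == j ⟧)) (trans (∑-cong shift (allFin n)) (∑-== i))
  where
  shift : ∀ j → ⟦ suc i == suc j ⟧ ≡ ⟦ i == j ⟧
  shift j with i ≟ j
  ... | yes _ = refl
  ... | no _  = refl

-- Row `i` is the closed neighbourhood N[i]. Read as a relation between two copies of the vertex
-- set, this is the bipartite double cover of `G` with a perfect matching added.
closed : ∀ {n} → Graph n → Graph n
closed G i j = (i == j) ∨ G i j

closed-sym : ∀ {n} {G : Graph n} → IsSimple G → ∀ i j → closed G i j ≡ closed G j i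
closed-sym simple i j = cong₂ _∨_ (==-sym i j) (IsSimple.symmetric simple i j)

-- Since `G` has no loops, the two disjuncts of `closed` exclude each other and their indicators add
-- up; the diagonal contributes the extra 1.
count-closed : ∀ {n} {G : Graph n} {d} → IsSimple G → IsRegular d G → ∀ i → count (closed G i) ≡ suc d
count-closed {n} {G} {d} simple regular i = begin
  count (closed G i)                                                   ≡⟨ count≡∑ (closed G i) ⟩
  ∑ (allFin n) (λ j → ⟦ closed G i j ⟧)                                ≡⟨ ∑-cong split (allFin n) ⟩
  ∑ (allFin n) (λ j → ⟦ i == j ⟧ + ⟦ G i j ⟧)                          ≡⟨ ∑-distrib-+ _ _ (allFin n) ⟩
  ∑ (allFin n) (λ j → ⟦ i == j ⟧) + ∑ (allFin n) (λ j → ⟦ G i j ⟧)     ≡⟨ cong₂ _+_ (∑-== i) (sym (count≡∑ (G i))) ⟩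
  suc (degree G i)                                                     ≡⟨ cong suc (regular i) ⟩
  suc d                                                                ∎
  where
  open ≡-Reasoning
  split : ∀ j → ⟦ closed G i j ⟧ ≡ ⟦ i == j ⟧ + ⟦ G i j ⟧
  split j with i ≟ j
  ... | yes refl = cong (λ g → suc ⟦ g ⟧) (sym (IsSimple.loopless simple i))
  ... | no _     = refl

∈-filterᵇ⁻ : ∀ {A : Set} (p : A → Bool) {x xs} → x ∈ filterᵇ p xs → p x ≡ true
∈-filterᵇ⁻ p {xs = xs} x∈ = Equivalence.to T-≡ (proj₂ (∈-filter⁻ (T? ∘ p) {xs = xs} x∈))

-- Extended line graphs

pairs : ∀ m → List (Fin m × Fin m)
pairs m = concatMap (λ u → map (u ,_) (allFin m)) (allFin m)

module _ {m : ℕ} (H : Graph m) where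

  listed : Fin m × Fin m → Bool
  listed (u , v) = (toℕ u <ᵇ toℕ v) ∧ H u v

  -- Adjacency in the extended line graph in a form invariant under swapping the ends of either
  -- edge. Equal edges fall under `a≡x`; `parallel` and `crossed` are the two ways of joining the
  -- ends of opposite edges of a 4-cycle.
  data Touch (a b x y : Fin m) : Set where
    a≡x      : a ≡ x → Touch a b x y
    a≡y      : a ≡ y → Touch a b x y
    b≡x      : b ≡ x → Touch a b x y
    b≡y      : b ≡ y → Touch a b x y
    parallel : H a x ≡ true → H b y ≡ true → Touch a b x y
    crossed  : H a y ≡ true → H b x ≡ true → Touch a b x y

  flipˡ : ∀ {a b x y} → Touch a b x y → Touch b a x y
  flipˡ (a≡x p)        = b≡x p
  flipˡ (a≡y p)        = b≡y p
  flipˡ (b≡x p)        = a≡x p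
  flipˡ (b≡y p)        = a≡y p
  flipˡ (parallel p q) = crossed q p
  flipˡ (crossed p q)  = parallel q p

  flipʳ : ∀ {a b x y} → Touch a b x y → Touch a b y x
  flipʳ (a≡x p)        = a≡y p
  flipʳ (a≡y p)        = a≡x p
  flipʳ (b≡x p)        = b≡y p
  flipʳ (b≡y p)        = b≡x p
  flipʳ (parallel p q) = crossed p q
  flipʳ (crossed p q)  = parallel p q

  share : (a b x y : Fin m) → Bool
  share a b x y = (a == x) ∨ (a == y) ∨ (b == x) ∨ (b == y)

  -- `extLine H e f` unfolds definitionally to `line` at `e == f`, `edge H e` and `edge H f`.
  -- Abstracting the equality test allows case analysis on the end vertices alone.
  line : Bool → (p q : Fin m × Fin m) → Bool
  line same (a , b) (x , y) = same ∨ share a b x y ∨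
    (not (share a b x y) ∧ ((H a x ∧ H b y) ∨ (H a y ∧ H b x)))

  line⇒Touch : ∀ same (p q : Fin m × Fin m) → let (a , b) = p ; (x , y) = q in
    (same ≡ true → a ≡ x) → line same p q ≡ true → Touch a b x y
  line⇒Touch true  p q same⇒ _ = a≡x (same⇒ refl)
  line⇒Touch false (a , b) (x , y) _ eq with a ≟ x | a ≟ y | b ≟ x | b ≟ y
  ... | yes p | _     | _     | _     = a≡x p
  ... | no _  | yes p | _     | _     = a≡y p
  ... | no _  | no _  | yes p | _     = b≡x p
  ... | no _  | no _  | no _  | yes p = b≡y p
  ... | no _  | no _  | no _  | no _  with H a x in ax | H b y in by
  ...   | true  | true  = parallel ax by
  ...   | true  | false = uncurry crossed (∧-true eq)
  ...   | false | _     = uncurry crossed (∧-true eq)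

  Touch⇒line : ∀ same (p q : Fin m × Fin m) → let (a , b) = p ; (x , y) = q in
    Touch a b x y → line same p q ≡ true
  Touch⇒line true  p q _ = refl
  Touch⇒line false (a , b) (x , y) t with a ≟ x | a ≟ y | b ≟ x | b ≟ y | t
  ... | yes _   | _       | _       | _       | _            = refl
  ... | no _    | yes _   | _       | _       | _            = refl
  ... | no _    | no _    | yes _   | _       | _            = refl
  ... | no _    | no _    | no _    | yes _   | _            = refl
  ... | no a≢x  | no _    | no _    | no _    | a≡x p        = contradiction p a≢x
  ... | no _    | no a≢y  | no _    | no _    | a≡y p        = contradiction p a≢y
  ... | no _    | no _    | no b≢x  | no _    | b≡x p        = contradiction p b≢x
  ... | no _    | no _    | no _    | no b≢y  | b≡y p        = contradiction p b≢y
  ... | no _    | no _    | no _    | no _    | parallel p q rewrite p | q = refl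
  ... | no _    | no _    | no _    | no _    | crossed p q  rewrite p | q with H a x ∧ H b y
  ...   | true  = refl
  ...   | false = refl

-- Orienting the bipartite graph.

module _ {m : ℕ} {H : Graph m} (simple : IsSimple H) (bipartite : IsBipartite H) where

  side : Fin m → Bool
  side = proj₁ bipartite

  H-sym : ∀ {u v} → H u v ≡ true → H v u ≡ true
  H-sym {u} {v} = trans (IsSimple.symmetric simple v u)

  -- A listed edge is ordered by vertex index, so its ends may have to be swapped. The left class is
  -- the one where `side` is true.
  left right : Fin m × Fin m → Fin m
  left  (a , b) = if side a then a else b
  right (a , b) = if side a then b else a

  arc : Fin m → Fin m → Bool
  arc u v = side u ∧ H u v

  arc⇒sides : ∀ {u v} → arc u v ≡ true → side u ≡ true × side v ≡ false
  arc⇒sides {u} {v} eq with u-left , uv ← ∧-true eq =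
    u-left , ≢true⇒≡false (λ v-left → proj₂ bipartite u v uv (trans u-left (sym v-left)))

  sides-differ : ∀ {u v} → side u ≡ true → side v ≡ false → u ≢ v
  sides-differ u-left v-right refl = contradiction (trans (sym u-left) v-right) λ ()

  edge-adjacent : ∀ e → uncurry H (edge H e) ≡ true
  edge-adjacent e = proj₂ (∧-true (∈-filterᵇ⁻ (listed H) {xs = pairs m} (∈-lookup e)))

  arc-oriented : ∀ {p} → uncurry H p ≡ true → arc (left p) (right p) ≡ true
  arc-oriented {a , b} ab with side a in sa
  ... | true  rewrite sa = ab
  ... | false with side b in sb
  ...   | true  = H-sym ab
  ...   | false = contradiction (trans sa (sym sb)) (proj₂ bipartite a b ab)

  -- Orienting an edge at most swaps its ends, and `Touch` is invariant under such swaps.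
  Touch-orient : ∀ (p q : Fin m × Fin m) → let (a , b) = p ; (x , y) = q in
    Touch H a b x y → Touch H (left p) (right p) (left q) (right q)
  Touch-orient (a , b) (x , y) t with side a | side x
  ... | true  | true  = t
  ... | true  | false = flipʳ H t
  ... | false | true  = flipˡ H t
  ... | false | false = flipˡ H (flipʳ H t)

  Touch-unorient : ∀ (p q : Fin m × Fin m) → let (a , b) = p ; (x , y) = q in
    Touch H (left p) (right p) (left q) (right q) → Touch H a b x y
  Touch-unorient (a , b) (x , y) t with side a | side x
  ... | true  | true  = t
  ... | true  | false = flipʳ H t
  ... | false | true  = flipˡ H t
  ... | false | false = flipˡ H (flipʳ H t)

  -- A shared vertex must be the common left end or the common right end, and then the two required
  -- arcs are the given ones. Of the two 4-cycle patterns, `parallel` would join two left vertices,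
  -- while `crossed` provides exactly the two arcs.
  Touch⇒arcs : ∀ {u v w z} → arc u v ≡ true → arc w z ≡ true → Touch H u v w z →
    arc u z ≡ true × arc w v ≡ true
  Touch⇒arcs uv wz t with arc⇒sides uv | arc⇒sides wz | t
  ... | su , sv | sw , sz | a≡x refl     = wz , uv
  ... | su , sv | sw , sz | a≡y u≡z      = contradiction u≡z (sides-differ su sz)
  ... | su , sv | sw , sz | b≡x v≡w      = contradiction (sym v≡w) (sides-differ sw sv)
  ... | su , sv | sw , sz | b≡y refl     = uv , wz
  ... | su , sv | sw , sz | parallel p _ = contradiction (trans su (sym sw)) (proj₂ bipartite _ _ p)
  ... | su , sv | sw , sz | crossed p q  = cong₂ _∧_ su p , cong₂ _∧_ sw (H-sym q)

  -- `crossed` also covers the degenerate cases `u ≡ w` and `v ≡ z`, for which `Touch⇒line` returns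
  -- the shared-vertex disjunct.
  arcs⇒Touch : ∀ {u v w z} → arc u z ≡ true → arc w v ≡ true → Touch H u v w z
  arcs⇒Touch uz wv = crossed (proj₂ (∧-true uz)) (H-sym (proj₂ (∧-true wv)))

  leftEnd rightEnd : Fin (numEdges H) → Fin m
  leftEnd  e = left (edge H e)
  rightEnd e = right (edge H e)

  extLine⇒arcs : ∀ e f → extLine H e f ≡ true →
    arc (leftEnd e) (rightEnd f) ≡ true × arc (leftEnd f) (rightEnd e) ≡ true
  extLine⇒arcs e f eq = Touch⇒arcs (arc-oriented (edge-adjacent e)) (arc-oriented (edge-adjacent f))
    (Touch-orient (edge H e) (edge H f) (line⇒Touch H (e == f) (edge H e) (edge H f)
      (λ e=f → cong (proj₁ ∘ edge H) (==⇒≡ e=f)) eq))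

  arcs⇒extLine : ∀ e f → arc (leftEnd e) (rightEnd f) ≡ true → arc (leftEnd f) (rightEnd e) ≡ true →
    extLine H e f ≡ true
  arcs⇒extLine e f p q = Touch⇒line H (e == f) (edge H e) (edge H f)
    (Touch-unorient (edge H e) (edge H f) (arcs⇒Touch p q))

  -- Each arc u → v of the orientation from left to right is counted once on the right, while
  -- edgeList lists its underlying edge as (u , v) or (v , u) according to the order on Fin m.
  ∑-edges : (φ : Fin m → Fin m → ℕ) → (∀ {u v} → arc u v ≡ false → φ u v ≡ 0) →
    ∑ (allFin (numEdges H)) (λ e → φ (leftEnd e) (rightEnd e))
    ≡ ∑ (allFin m) (λ u → ∑ (allFin m) (φ u))
  ∑-edges φ φ-zero = begin
    ∑ (allFin (numEdges H)) (λ e → ψ (edge H e))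
      ≡⟨ ∑-lookup ψ (edgeList H) ⟩
    ∑ (edgeList H) ψ
      ≡⟨ ∑-filterᵇ (listed H) ψ (pairs m) ⟩
    ∑ (pairs m) (λ p → ⟦ listed H p ⟧ * ψ p)
      ≡⟨ ∑-concatMap _ _ (allFin m) ⟩
    ∑ (allFin m) (λ u → ∑ (map (u ,_) (allFin m)) (λ p → ⟦ listed H p ⟧ * ψ p))
      ≡⟨ ∑-cong (λ u → ∑-map _ (u ,_) (allFin m)) (allFin m) ⟩
    ∑² (λ u v → ⟦ listed H (u , v) ⟧ * ψ (u , v))
      ≡⟨ ∑-cong (λ u → ∑-cong (λ v → split u v) (allFin m)) (allFin m) ⟩
    ∑² (λ u v → forward u v + backward u v)
      ≡⟨ ∑²-+ forward backward ⟩
    ∑² forward + ∑² backward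
      -- After this exchange the backward terms, too, are indexed by tail and head of the arc, so
      -- both summands multiply the same `φ u v`.
      ≡⟨ cong (∑² forward +_) (∑-comm backward (allFin m) (allFin m)) ⟩
    ∑² forward + ∑² (λ u v → backward v u)
      ≡⟨ sym (∑²-+ forward (λ u v → backward v u)) ⟩
    ∑² (λ u v → forward u v + backward v u)
      ≡⟨ ∑-cong (λ u → ∑-cong (λ v → merge u v) (allFin m)) (allFin m) ⟩
    ∑² φ ∎
    where
    open ≡-Reasoning

    ψ : Fin m × Fin m → ℕ
    ψ p = φ (left p) (right p)

    ∑² : (Fin m → Fin m → ℕ) → ℕ
    ∑² f = ∑ (allFin m) (λ u → ∑ (allFin m) (f u))

    ∑²-+ : ∀ f g → ∑² (λ u v → f u v + g u v) ≡ ∑² f + ∑² g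
    ∑²-+ f g = trans (∑-cong (λ u → ∑-distrib-+ (f u) (g u) (allFin m)) (allFin m)) (∑-distrib-+ _ _ (allFin m))

    forward backward : Fin m → Fin m → ℕ
    forward  u v = ⟦ listed H (u , v) ∧ side u ⟧ * φ u v
    backward u v = ⟦ listed H (u , v) ∧ not (side u) ⟧ * φ v u

    split : ∀ u v → ⟦ listed H (u , v) ⟧ * ψ (u , v) ≡ forward u v + backward u v
    split u v with listed H (u , v) | side u
    ... | true  | true  = sym (+-identityʳ _)
    ... | true  | false = refl
    ... | false | true  = refl
    ... | false | false = refl

    once : ∀ a b → a ≢ b → ⟦ a <ᵇ b ⟧ + ⟦ b <ᵇ a ⟧ ≡ 1
    once zero    zero    a≢b = contradiction refl a≢b
    once zero    (suc b) a≢b = refl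
    once (suc a) zero    a≢b = refl
    once (suc a) (suc b) a≢b = once a b (a≢b ∘ cong suc)

    ⟦∧true∧true⟧ : ∀ a {b c} → b ≡ true → c ≡ true → ⟦ (a ∧ b) ∧ c ⟧ ≡ ⟦ a ⟧
    ⟦∧true∧true⟧ true  refl refl = refl
    ⟦∧true∧true⟧ false refl refl = refl

    merge : ∀ u v → forward u v + backward v u ≡ φ u v
    merge u v with arc u v in uv
    ... | false = begin
      forward u v + backward v u
        ≡⟨ cong₂ _+_ (vanish ⟦ listed H (u , v) ∧ side u ⟧)
             (vanish ⟦ listed H (v , u) ∧ not (side v) ⟧) ⟩
      0
        ≡⟨ sym (φ-zero uv) ⟩
      φ u v                        ∎
      where
      vanish : ∀ c → c * φ u v ≡ 0
      vanish c = trans (cong (c *_) (φ-zero uv)) (*-zeroʳ c)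
    ... | true with su , sv ← arc⇒sides uv | _ , Huv ← ∧-true {side u} uv = begin
      forward u v + backward v u
        ≡⟨ cong₂ (λ x y → x * φ u v + y * φ u v)
             (⟦∧true∧true⟧ (toℕ u <ᵇ toℕ v) Huv su)
             (⟦∧true∧true⟧ (toℕ v <ᵇ toℕ u) (H-sym Huv) (cong not sv)) ⟩
      ⟦ toℕ u <ᵇ toℕ v ⟧ * φ u v + ⟦ toℕ v <ᵇ toℕ u ⟧ * φ u v
        ≡⟨ sym (*-distribʳ-+ (φ u v) ⟦ toℕ u <ᵇ toℕ v ⟧ ⟦ toℕ v <ᵇ toℕ u ⟧) ⟩
      (⟦ toℕ u <ᵇ toℕ v ⟧ + ⟦ toℕ v <ᵇ toℕ u ⟧) * φ u v
        ≡⟨ cong (_* φ u v) (once (toℕ u) (toℕ v) (sides-differ su sv ∘ toℕ-injective)) ⟩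
      1 * φ u v
        ≡⟨ *-identityˡ (φ u v) ⟩
      φ u v ∎

  -- Applies `∑-edges` one vertex at a time; `Ψ` vanishes off arcs, so the sum may run over all
  -- pairs of vertex maps. The hypothesis relating `Φ` to `Ψ` quantifies over all `l` and `r`
  -- pointwise equal to the ends of `f`, because `cons` of the ends and the ends of a `cons` agree
  -- only pointwise.
  ∑-edge-maps : ∀ {n} (Φ : (Fin n → Fin (numEdges H)) → ℕ) (Ψ : (Fin n → Fin m) → (Fin n → Fin m) → ℕ) →
    (∀ f l r → (∀ i → l i ≡ leftEnd (f i)) → (∀ i → r i ≡ rightEnd (f i)) → Φ f ≡ Ψ l r) →
    (∀ l r i → arc (l i) (r i) ≡ false → Ψ l r ≡ 0) →
    ∑ (allFuns n (numEdges H)) Φ ≡ ∑ (allFuns n m) (λ l → ∑ (allFuns n m) (Ψ l))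
  ∑-edge-maps {zero}  Φ Ψ match vanish =
    cong (_+ 0) (trans (match _ _ _ (λ ()) (λ ())) (sym (+-identityʳ _)))
  ∑-edge-maps {suc n} Φ Ψ match vanish = begin
    ∑ (allFuns (suc n) (numEdges H)) Φ
      ≡⟨ ∑-allFuns-suc Φ ⟩
    ∑ (allFin (numEdges H)) (λ e → ∑ (allFuns n (numEdges H)) (Φ ∘ cons e))
      ≡⟨ ∑-cong (λ e → ∑-edge-maps (Φ ∘ cons e) (λ l r → Ψ (cons (leftEnd e) l) (cons (rightEnd e) r))
           (λ f l r lf rf → match _ _ _ (λ { zero → refl ; (suc i) → lf i }) (λ { zero → refl ; (suc i) → rf i }))
           (λ l r i → vanish _ _ (suc i))) (allFin (numEdges H)) ⟩
    ∑ (allFin (numEdges H)) (λ e → φ (leftEnd e) (rightEnd e))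
      ≡⟨ ∑-edges φ φ-zero ⟩
    ∑ (allFin m) (λ u → ∑ (allFin m) (φ u))
      -- Moving the sum over `v` inside the sum over `l` lets `v` and `r` be reassembled into one
      -- map.
      ≡⟨ ∑-cong (λ u → ∑-comm (λ v l → ∑ (allFuns n m) (λ r → Ψ (cons u l) (cons v r)))
           (allFin m) (allFuns n m)) (allFin m) ⟩
    ∑ (allFin m) (λ u → ∑ (allFuns n m) (λ l →
      ∑ (allFin m) (λ v → ∑ (allFuns n m) (λ r → Ψ (cons u l) (cons v r)))))
      ≡⟨ ∑-cong (λ u → ∑-cong (λ l → sym (∑-allFuns-suc (Ψ (cons u l)))) (allFuns n m)) (allFin m) ⟩
    ∑ (allFin m) (λ u → ∑ (allFuns n m) (λ l → ∑ (allFuns (suc n) m) (Ψ (cons u l))))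
      ≡⟨ sym (∑-allFuns-suc (λ l → ∑ (allFuns (suc n) m) (Ψ l))) ⟩
    ∑ (allFuns (suc n) m) (λ l → ∑ (allFuns (suc n) m) (Ψ l)) ∎
    where
    open ≡-Reasoning
    φ : Fin m → Fin m → ℕ
    φ u v = ∑ (allFuns n m) (λ l → ∑ (allFuns n m) (λ r → Ψ (cons u l) (cons v r)))
    φ-zero : ∀ {u v} → arc u v ≡ false → φ u v ≡ 0
    φ-zero uv = ∑-zero (allFuns n m) λ _ → ∑-zero (allFuns n m) λ _ → vanish _ _ zero uv

  -- The `ν` of the inequality. As `arc` includes the side condition, a list with a vertex outside
  -- the left class gets 0, so sums can range over all vertices.
  commonNbrs : List (Fin m) → ℕ
  commonNbrs us = ∑ (allFin m) (λ v → ⟦ all (λ u → arc u v) us ⟧)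

  -- In the proof, l and r are the values on the two halves of the double cover.
  hom-extLine : ∀ {n} {G : Graph n} → IsSimple G → hom G (extLine H) ≡
    ∑ (allFuns n m) (λ l → ∏ (allFin n) (λ j → commonNbrs (restrict (λ i → closed G i j) l)))
  hom-extLine {n} {G} G-simple = begin
    hom G (extLine H)
      ≡⟨ length-filterᵇ (isHom G (extLine H)) (allFuns n _) ⟩
    ∑ (allFuns n (numEdges H)) (λ f → ⟦ isHom G (extLine H) f ⟧)
      ≡⟨ ∑-edge-maps _ (λ l r → ⟦ doubleHom l r ⟧) match vanish ⟩
    ∑ (allFuns n m) (λ l → ∑ (allFuns n m) (λ r → ⟦ doubleHom l r ⟧))
      -- For fixed `l`, the constraint at `j` involves only the value `r j`, so the sum over `r`
      -- factorises.
      ≡⟨ ∑-cong (λ l → trans (∑-cong (λ r → ⟦all⟧ _ (allFin n)) (allFuns n m))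
           (∑-allFuns-∏ (λ j v → ⟦ all (λ u → arc u v) (restrict (λ i → closed G i j) l) ⟧))) (allFuns n m) ⟩
    ∑ (allFuns n m) (λ l → ∏ (allFin n) (λ j → commonNbrs (restrict (λ i → closed G i j) l))) ∎
    where
    open ≡-Reasoning

    -- The conditions are grouped by the right vertex `j`, giving the product form needed for
    -- summing out `r`.
    doubleHom : (Fin n → Fin m) → (Fin n → Fin m) → Bool
    doubleHom l r = all (λ j → all (λ u → arc u (r j)) (restrict (λ i → closed G i j) l)) (allFin n)

    doubleHom⇒ : ∀ l r → doubleHom l r ≡ true → ∀ i j → closed G i j ≡ true → arc (l i) (r j) ≡ true
    doubleHom⇒ l r eq i j = all-restrict⇒ (λ u → arc u (r j)) (λ i → closed G i j) l (all-allFin⇒ _ eq j) i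

    doubleHom⇐ : ∀ l r → (∀ i j → closed G i j ≡ true → arc (l i) (r j) ≡ true) → doubleHom l r ≡ true
    doubleHom⇐ l r h = all-allFin⇐ _ λ j → all-restrict⇐ (λ u → arc u (r j)) (λ i → closed G i j) l (λ i → h i j)

    edge⇒closed : ∀ {i j} → G i j ≡ true → closed G i j ≡ true
    edge⇒closed {i} {j} Gij with i == j
    ... | true  = refl
    ... | false = Gij

    -- Adjacency of `f i` and `f j` amounts to two arcs, which are the double cover's conditions at
    -- (`i`, `j`) and (`j`, `i`). The matching conditions at (`i`, `i`) hold because `f i` is itself
    -- an edge.
    match : ∀ f l r → (∀ i → l i ≡ leftEnd (f i)) → (∀ i → r i ≡ rightEnd (f i)) →
      ⟦ isHom G (extLine H) f ⟧ ≡ ⟦ doubleHom l r ⟧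
    match f l r lf rf = cong ⟦_⟧ (bool-ext
      (λ f-hom → doubleHom⇐ l r λ i j → subst₂ (λ u v → closed G i j ≡ true → arc u v ≡ true)
        (sym (lf i)) (sym (rf j)) (arcs f-hom i j))
      (λ lr-hom → isHom⇐ G (extLine H) f λ i j Gij → arcs⇒extLine (f i) (f j)
        (subst₂ (λ u v → arc u v ≡ true) (lf i) (rf j) (doubleHom⇒ l r lr-hom i j (edge⇒closed Gij)))
        (subst₂ (λ u v → arc u v ≡ true) (lf j) (rf i) (doubleHom⇒ l r lr-hom j i
          (edge⇒closed (trans (IsSimple.symmetric G-simple j i) Gij))))))
      where
      arcs : isHom G (extLine H) f ≡ true → ∀ i j → closed G i j ≡ true →
        arc (leftEnd (f i)) (rightEnd (f j)) ≡ true
      arcs f-hom i j cl with i ≟ j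
      ... | yes refl = arc-oriented (edge-adjacent (f i))
      ... | no _     = proj₁ (extLine⇒arcs (f i) (f j) (isHom⇒ G (extLine H) f f-hom i j cl))

    -- The matching edge at `i` forces `l i` and `r i` to form an arc.
    vanish : ∀ l r i → arc (l i) (r i) ≡ false → ⟦ doubleHom l r ⟧ ≡ 0
    vanish l r i li-ri = cong ⟦_⟧ (≢true⇒≡false λ eq → contradiction
      (trans (sym (doubleHom⇒ l r eq i i (cong (_∨ G i i) (==-refl i)))) li-ri) λ ())

-- Complete graphs and the final bound.

K-simple : ∀ n → IsSimple (K n)
K-simple n = record
  { symmetric = λ i j → cong not (==-sym i j)
  ; loopless  = λ i → cong not (==-refl i)
  }

closed-K : ∀ {n} (i j : Fin n) → closed (K n) i j ≡ true
closed-K i j with i == j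
... | true  = refl
... | false = refl

restrict-true : ∀ {n} {A : Set} {s : Fin n → Bool} → (∀ i → s i ≡ true) → (f : Fin n → A) →
  restrict s f ≡ tabulate f
restrict-true {zero}  s≡true f = refl
restrict-true {suc n} s≡true f rewrite s≡true zero = cong (f zero ∷_) (restrict-true (s≡true ∘ suc) (f ∘ suc))

-- `tabulate` matches `allFuns n k` with the words of length `n`, each hit once; both sums peel off
-- the head first.
∑-allFuns-tabulate : ∀ n {k} (W : List (Fin k) → ℕ) → ∑ (allFuns n k) (W ∘ tabulate) ≡ ∑Lists n W
∑-allFuns-tabulate zero    W = +-identityʳ (W [])
∑-allFuns-tabulate (suc n) {k} W = trans (∑-allFuns-suc {n} {k} (W ∘ tabulate))
  (∑-cong (λ x → ∑-allFuns-tabulate n (W ∘ (x ∷_))) (allFin k))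

theorem2 : (m : ℕ) (H : Graph m) → IsSimple H → IsBipartite H →
    (d : ℕ) → 1 ≤ d → (n : ℕ) (G : Graph n) → IsSimple G → IsRegular d G →
    hom G (extLine H) ^ suc d ≤ hom (K (suc d)) (extLine H) ^ n
theorem2 m H simple bipartite d _ n G G-simple regular = begin
  hom G (extLine H) ^ D
    ≡⟨ cong (_^ D) (hom-extLine simple bipartite G-simple) ⟩
  ∑ (allFuns n m) (λ l → ∏ (allFin n) (λ j → ν (restrict (λ i → closed G i j) l))) ^ D
    -- The sets are the N[j], and each factor is bounded by itself: raising the product to the power
    -- `D` gives the hypothesis with equality.
    ≤⟨ finner (allFin n) D (closed G) (count-closed G-simple regular) _ (λ _ us → ν us ^ D)
         (λ l → ≤-reflexive (∏-^ _ D (allFin n))) ⟩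
  ∏ (allFin n) (λ j → ∑Lists (count (λ i → closed G i j)) (λ us → ν us ^ D))
    ≡⟨ ∏-cong (λ j → cong (λ c → ∑Lists c (λ us → ν us ^ D)) (column j)) (allFin n) ⟩
  ∏ (allFin n) (λ _ → ∑Lists D (λ us → ν us ^ D))
    ≡⟨ ∏-const (∑Lists D (λ us → ν us ^ D)) (allFin n) ⟩
  ∑Lists D (λ us → ν us ^ D) ^ length (allFin n)
    ≡⟨ cong₂ _^_ (sym hom-K) (length-tabulate {n = n} (λ i → i)) ⟩
  hom (K D) (extLine H) ^ n ∎
  where
  open ≤-Reasoning
  D = suc d

  ν : List (Fin m) → ℕ
  ν = commonNbrs simple bipartite

  -- The size of N[j] is a column count of `closed G`, while `count-closed` counts rows; symmetry of
  -- `G` links the two.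
  column : ∀ j → count (λ i → closed G i j) ≡ D
  column j = trans (count≡∑ (λ i → closed G i j)) (trans
    (∑-cong (λ i → cong ⟦_⟧ (closed-sym G-simple i j)) (allFin n))
    (trans (sym (count≡∑ (closed G j))) (count-closed G-simple regular j)))

  -- In the complete graph every N[j] is the whole vertex set, so the `D` factors coincide and form
  -- the power that appears in the bound.
  row : ∀ l → ∏ (allFin D) (λ j → ν (restrict (λ i → closed (K D) i j) l)) ≡ ν (tabulate l) ^ D
  row l = begin-equality
    ∏ (allFin D) (λ j → ν (restrict (λ i → closed (K D) i j) l))
      ≡⟨ ∏-cong (λ j → cong ν (restrict-true (λ i → closed-K i j) l)) (allFin D) ⟩
    ∏ (allFin D) (λ _ → ν (tabulate l))
      ≡⟨ ∏-const (ν (tabulate l)) (allFin D) ⟩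
    ν (tabulate l) ^ length (allFin D)
      ≡⟨ cong (ν (tabulate l) ^_) (length-tabulate {n = D} (λ i → i)) ⟩
    ν (tabulate l) ^ D ∎

  hom-K : hom (K D) (extLine H) ≡ ∑Lists D (λ us → ν us ^ D)
  hom-K = trans (hom-extLine simple bipartite (K-simple D))
    (trans (∑-cong row (allFuns D m)) (∑-allFuns-tabulate D (λ us → ν us ^ D)))
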